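{- Let $k$ be a nonnegative integer. Then there exist rational numbers $\xi_0,\dots,\xi_{k-1}$ (depending only on $k$) such that for every strict partition $\lambda$, with inner corner contents $x_0,\dots,x_m$, and every $i\in\{0,\dots,m\}$ for which $\lambda^{i+}$ is defined, $$q_k(\lambda^{i+})-q_k(\lambda)=\sum_{j=0}^{k-1}\xi_j\binom{x_i}{2}^j.$$
   Context: A strict partition is a finite strictly decreasing sequence of positive integers $\lambda=(\lambda_1>\cdots>\lambda_\ell)$ (the empty sequence is allowed); $\ell(\lambda)=\ell$, and $\lambda_i=0$ for $i>\ell(\lambda)$. The (shifted Young) diagram of $\lambda$ is the set of boxes $(i,j)$ with $1\le i\le\ell(\lambda)$, $i+1\le j\le i+\lambda_i$ (row $i$, column $j$); $\lambda$ is identified with its diagram; the content of $\square=(i,j)$ is $c_\square=j-i$. An outer corner of $\lambda$ is a box of $\lambda$ whose removal leaves the diagram of a strict partition. Let $(\alpha_1,\beta_1),\dots,(\alpha_m,\beta_m)$ be the outer corners with $\alpha_1>\cdots>\alpha_m$, and $y_j=\beta_j-\alpha_j$. Set $\alpha_{m+1}=0$, $\beta_0=\ell(\lambda)+1$, and $x_i=\beta_i-\alpha_{i+1}$ for $0\le i\le m$ (inner corner contents); one has $x_0=1\le y_1<x_1<\cdots<y_m<x_m$. For $k\ge0$, $q_k(\lambda)=\sum_{i=0}^m\binom{x_i}{2}^k-\sum_{i=1}^m\binom{y_i}{2}^k$. For $1\le i\le m$, $\lambda^{i+}$ is the strict partition obtained from $\lambda$ by adding a box of content $x_i$; if $m=0$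 or $y_1>1$, $\lambda^{0+}$ is the strict partition obtained by adding a box of content $x_0=1$ (a new row of length 1), and $\lambda^{0+}$ is undefined otherwise. -}

module Defs where

open import Data.Empty using (⊥-elim)
open import Data.Fin using (Fin; zero; suc)
open import Data.Integer using (ℤ; _⊖_)
open import Data.List using (List; []; _∷_; length; map; concatMap; filter; upTo; downFrom)
open import Data.List.Relation.Unary.All using (All; []; _∷_)
open import Data.List.Relation.Unary.Linked as Linked using (Linked; []; [-]; _∷_)
open import Data.Nat
open import Data.Nat.Combinatorics using (_C_)
open import Data.Nat.Properties
open import Data.Product using (Σ-syntax; ∃-syntax; _×_; _,_; proj₁; proj₂)
open import Data.Product.Properties using (,-injectiveˡ)
open import Data.Sum using (_⊎_; inj₁; inj₂)
open import Data.Unit using (⊤; tt)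
open import Data.Vec as Vec using (Vec; []; _∷_; _∷ʳ_)
open import Function.Base using (_∘_)
open import Function.Bundles using (_⇔_; mk⇔; Equivalence)
open import Relation.Binary.PropositionalEquality
open import Relation.Nullary using (¬_; Dec; yes; no)
open import Relation.Nullary.Decidable using (map′; _×-dec_; _⊎-dec_)

open Equivalence using (to; from)

record StrictPartition : Set where
  constructor strictPartition
  field
    parts      : List ℕ
    decreasing : Linked _>_ parts
    positive   : All (0 <_) parts

open StrictPartition public

ℓ : StrictPartition → ℕ
ℓ μ = length (parts μ)

-- Rows are numbered from 1; the value at row 0 is never used.
partAt : List ℕ → ℕ → ℕ
partAt []       _             = 0
partAt (p ∷ ps) zero          = 0
partAt (p ∷ ps) (suc zero)    = p
partAt (p ∷ ps) (suc (suc i)) = partAt ps (suc i)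

part : StrictPartition → ℕ → ℕ
part μ = partAt (parts μ)

-- (row , column)
Box : Set
Box = ℕ × ℕ

row col : Box → ℕ
row = proj₁
col = proj₂

-- Boxes of a shifted diagram, and boxes that can be added to one, satisfy
-- row < col, so the subtraction is never truncated where it is used.
content : Box → ℕ
content b = col b ∸ row b

infix 4 _∈ᵈ_ _∉ᵈ_

_∈ᵈ_ _∉ᵈ_ : Box → StrictPartition → Set
(i , j) ∈ᵈ μ = (1 ≤ i × i ≤ ℓ μ) × (i + 1 ≤ j × j ≤ i + part μ i)
b ∉ᵈ μ = ¬ (b ∈ᵈ μ)

IsOuterCorner : StrictPartition → Box → Set
IsOuterCorner μ b =
  b ∈ᵈ μ × (∃[ ν ] (∀ c → c ∈ᵈ ν ⇔ (c ∈ᵈ μ × c ≢ b)))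

------------------------------------------------------------------------
-- Decidability of IsOuterCorner: a box is an outer corner iff it is the
-- last one of its row i and either λᵢ = 1 or λᵢ₊₁ + 1 < λᵢ.

Shrinkable : List ℕ → ℕ → Set
Shrinkable ps i = partAt ps i ≡ 1 ⊎ partAt ps (suc i) + 1 < partAt ps i

shrink : List ℕ → ℕ → List ℕ
shrink []                 _             = []
shrink (p ∷ ps)           zero          = p ∷ ps
shrink (zero ∷ ps)        (suc zero)    = []
shrink (suc zero ∷ ps)    (suc zero)    = []
shrink (suc (suc p) ∷ ps) (suc zero)    = suc p ∷ ps
shrink (p ∷ ps)           (suc (suc i)) = p ∷ shrink ps (suc i)

shrink-linked : ∀ p ps i → Linked _>_ (p ∷ ps) → Shrinkable ps i →
                Linked _>_ (p ∷ shrink ps i)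
shrink-linked p [] i lk s = [-]
shrink-linked p (q ∷ ps) zero lk s = lk
shrink-linked p (zero ∷ ps) (suc zero) lk s = [-]
shrink-linked p (suc zero ∷ ps) (suc zero) lk s = [-]
shrink-linked p (suc (suc q) ∷ ps) (suc zero) (p>q ∷ lk) (inj₁ ())
shrink-linked p (suc (suc q) ∷ []) (suc zero) (p>q ∷ lk) (inj₂ s) =
  <-trans (n<1+n _) p>q ∷ [-]
shrink-linked p (suc (suc q) ∷ r ∷ ps) (suc zero) (p>q ∷ _ ∷ lk) (inj₂ s) =
  <-trans (n<1+n _) p>q ∷ s≤s⁻¹ (subst (_< suc (suc q)) (+-comm r 1) s) ∷ lk
shrink-linked p (zero ∷ ps) (suc (suc i)) (p>q ∷ lk) s =
  p>q ∷ shrink-linked zero ps (suc i) lk s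
shrink-linked p (suc zero ∷ ps) (suc (suc i)) (p>q ∷ lk) s =
  p>q ∷ shrink-linked 1 ps (suc i) lk s
shrink-linked p (suc (suc q) ∷ ps) (suc (suc i)) (p>q ∷ lk) s =
  p>q ∷ shrink-linked (suc (suc q)) ps (suc i) lk s

above : ∀ ps → Linked _>_ ps → ∃[ p ] Linked _>_ (p ∷ ps)
above []       lk = 0 , [-]
above (p ∷ ps) lk = suc p , n<1+n p ∷ lk

shrink-positive : ∀ ps i → All (0 <_) ps → All (0 <_) (shrink ps i)
shrink-positive [] i ap = []
shrink-positive (p ∷ ps) zero ap = ap
shrink-positive (zero ∷ ps) (suc zero) ap = []
shrink-positive (suc zero ∷ ps) (suc zero) ap = []
shrink-positive (suc (suc p) ∷ ps) (suc zero) (_ ∷ ap) = z<s ∷ ap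
shrink-positive (zero ∷ ps) (suc (suc i)) (a ∷ ap) =
  a ∷ shrink-positive ps (suc i) ap
shrink-positive (suc zero ∷ ps) (suc (suc i)) (a ∷ ap) =
  a ∷ shrink-positive ps (suc i) ap
shrink-positive (suc (suc p) ∷ ps) (suc (suc i)) (a ∷ ap) =
  a ∷ shrink-positive ps (suc i) ap

partAt-zero : ∀ ps → partAt ps 0 ≡ 0
partAt-zero []       = refl
partAt-zero (_ ∷ _)  = refl

partAt-shrink-same : ∀ ps i → partAt (shrink ps i) i ≡ pred (partAt ps i)
partAt-shrink-same [] i = refl
partAt-shrink-same (p ∷ ps) zero = refl
partAt-shrink-same (zero ∷ ps) (suc zero) = refl
partAt-shrink-same (suc zero ∷ ps) (suc zero) = refl
partAt-shrink-same (suc (suc p) ∷ ps) (suc zero) = refl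
partAt-shrink-same (zero ∷ ps) (suc (suc i)) = partAt-shrink-same ps (suc i)
partAt-shrink-same (suc zero ∷ ps) (suc (suc i)) = partAt-shrink-same ps (suc i)
partAt-shrink-same (suc (suc p) ∷ ps) (suc (suc i)) = partAt-shrink-same ps (suc i)

partAt-shrink-other : ∀ ps i r → Linked _>_ ps → All (0 <_) ps → r ≢ i →
                      partAt (shrink ps i) r ≡ partAt ps r
partAt-shrink-other ps i zero lk ap r≢i =
  trans (partAt-zero (shrink ps i)) (sym (partAt-zero ps))
partAt-shrink-other [] i (suc r) lk ap r≢i = refl
partAt-shrink-other (p ∷ ps) zero (suc r) lk ap r≢i = refl
partAt-shrink-other (p ∷ ps) (suc zero) (suc zero) lk ap r≢i = ⊥-elim (r≢i refl)
partAt-shrink-other (zero ∷ ps) (suc zero) (suc (suc r)) lk (() ∷ ap) r≢i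
partAt-shrink-other (suc zero ∷ []) (suc zero) (suc (suc r)) lk ap r≢i = refl
partAt-shrink-other (suc zero ∷ q ∷ ps) (suc zero) (suc (suc r)) (1>q ∷ _) (_ ∷ 0<q ∷ _) r≢i =
  ⊥-elim (<⇒≱ 1>q 0<q)
partAt-shrink-other (suc (suc p) ∷ ps) (suc zero) (suc (suc r)) lk ap r≢i = refl
partAt-shrink-other (zero ∷ ps) (suc (suc i)) (suc r) lk (() ∷ ap) r≢i
partAt-shrink-other (suc zero ∷ ps) (suc (suc i)) (suc zero) lk ap r≢i = refl
partAt-shrink-other (suc (suc p) ∷ ps) (suc (suc i)) (suc zero) lk ap r≢i = refl
partAt-shrink-other (suc zero ∷ ps) (suc (suc i)) (suc (suc r)) lk (_ ∷ ap) r≢i =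
  partAt-shrink-other ps (suc i) (suc r) (Linked.tail lk) ap (r≢i ∘ cong suc)
partAt-shrink-other (suc (suc p) ∷ ps) (suc (suc i)) (suc (suc r)) lk (_ ∷ ap) r≢i =
  partAt-shrink-other ps (suc i) (suc r) (Linked.tail lk) ap (r≢i ∘ cong suc)

partAt>0⇒row : ∀ ps i → 0 < partAt ps i → 1 ≤ i × i ≤ length ps
partAt>0⇒row (p ∷ ps) (suc zero)    h = s≤s z≤n , s≤s z≤n
partAt>0⇒row (p ∷ ps) (suc (suc i)) h = s≤s z≤n , s≤s (proj₂ (partAt>0⇒row ps (suc i) h))

partAt-decreasing : ∀ ps i → Linked _>_ ps → 0 < partAt ps (suc (suc i)) →
                    partAt ps (suc (suc i)) < partAt ps (suc i)
partAt-decreasing (p ∷ q ∷ ps) zero    (p>q ∷ _) h = p>q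
partAt-decreasing (p ∷ q ∷ ps) (suc i) (_ ∷ lk)  h = partAt-decreasing (q ∷ ps) i lk h

∈ᵈ-intro : ∀ μ {i j} → i < j → j ≤ i + part μ i → (i , j) ∈ᵈ μ
∈ᵈ-intro μ {i} {j} i<j j≤ =
  partAt>0⇒row (parts μ) i (+-cancelˡ-< i 0 _ (subst (_< i + part μ i) (sym (+-identityʳ i)) (<-≤-trans i<j j≤)))
  , subst (_≤ j) (+-comm 1 i) i<j , j≤

∈ᵈ-< : ∀ μ {i j} → (i , j) ∈ᵈ μ → i < j
∈ᵈ-< μ {i} {j} (_ , l , _) = subst (_≤ j) (+-comm i 1) l

∈ᵈ-≤ : ∀ μ {i j} → (i , j) ∈ᵈ μ → j ≤ i + part μ i
∈ᵈ-≤ μ (_ , _ , u) = u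

CornerCondition : StrictPartition → Box → Set
CornerCondition μ (i , j) = (i < j × j ≡ i + part μ i) × Shrinkable (parts μ) i

cornerCondition? : ∀ μ b → Dec (CornerCondition μ b)
cornerCondition? μ (i , j) =
  ((i <? j) ×-dec (j ≟ i + part μ i)) ×-dec
  ((part μ i ≟ 1) ⊎-dec (part μ (suc i) + 1 <? part μ i))

cornerCondition⇒isOuterCorner : ∀ μ b → CornerCondition μ b → IsOuterCorner μ b
cornerCondition⇒isOuterCorner μ (i , j) ((i<j , j≡) , s) =
  ∈ᵈ-intro μ i<j (≤-reflexive j≡) , ν , λ c → mk⇔ (fwd c) (bwd c)
  where
  ps = parts μ
  ν : StrictPartition
  ν = strictPartition (shrink ps i)
        (Linked.tail (shrink-linked _ ps i (proj₂ (above ps (decreasing μ))) s))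
        (shrink-positive ps i (positive μ))

  same : part ν i ≡ pred (part μ i)
  same = partAt-shrink-same ps i

  other : ∀ r → r ≢ i → part ν r ≡ part μ r
  other r = partAt-shrink-other ps i r (decreasing μ) (positive μ)

  positiveRow : 0 < part μ i
  positiveRow = +-cancelˡ-< i 0 _ (subst₂ _<_ (sym (+-identityʳ i)) j≡ i<j)

  predj : suc (i + pred (part μ i)) ≡ j
  predj = trans (sym (+-suc i _))
            (trans (cong (i +_) (suc-pred (part μ i) {{>-nonZero positiveRow}})) (sym j≡))

  fwd : ∀ c → c ∈ᵈ ν → c ∈ᵈ μ × c ≢ (i , j)
  fwd (r , t) h with r ≟ i
  ... | no r≢i = ∈ᵈ-intro μ (∈ᵈ-< ν h) (subst (λ z → t ≤ r + z) (other r r≢i) (∈ᵈ-≤ ν h))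
               , λ e → r≢i (,-injectiveˡ e)
  ... | yes refl = ∈ᵈ-intro μ (∈ᵈ-< ν h) (subst (t ≤_) j≡ (<⇒≤ t<j))
                 , λ { refl → <-irrefl refl t<j }
    where
    t<j : t < j
    t<j = subst (t <_) predj (s≤s (subst (λ z → t ≤ i + z) same (∈ᵈ-≤ ν h)))

  bwd : ∀ c → c ∈ᵈ μ × c ≢ (i , j) → c ∈ᵈ ν
  bwd (r , t) (h , c≢) with r ≟ i
  ... | no r≢i = ∈ᵈ-intro ν (∈ᵈ-< μ h) (subst (λ z → t ≤ r + z) (sym (other r r≢i)) (∈ᵈ-≤ μ h))
  ... | yes refl = ∈ᵈ-intro ν (∈ᵈ-< μ h) (subst (λ z → t ≤ i + z) (sym same) (s≤s⁻¹ t<j))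
    where
    t<j : t < suc (i + pred (part μ i))
    t<j = subst (t <_) (sym predj)
            (≤∧≢⇒< (subst (t ≤_) (sym j≡) (∈ᵈ-≤ μ h)) λ { refl → c≢ refl })

isOuterCorner⇒cornerCondition : ∀ μ b → IsOuterCorner μ b → CornerCondition μ b
isOuterCorner⇒cornerCondition μ (i , j) (h , ν , spec) = (i<j , j≡) , s
  where
  i<j : i < j
  i<j = ∈ᵈ-< μ h

  b∉ν : (i , j) ∉ᵈ ν
  b∉ν k = proj₂ (to (spec (i , j)) k) refl

  j≡ : j ≡ i + part μ i
  j≡ with m≤n⇒m<n∨m≡n (∈ᵈ-≤ μ h)
  ... | inj₂ e = e
  ... | inj₁ j< = ⊥-elim (b∉ν (∈ᵈ-intro ν i<j (≤-trans (n≤1+n j) (∈ᵈ-≤ ν next))))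
    where
    next : (i , suc j) ∈ᵈ ν
    next = from (spec (i , suc j))
             (∈ᵈ-intro μ (<-trans i<j (n<1+n j)) j< , λ e → 1+n≢n (cong proj₂ e))

  positiveRow : 0 < part μ i
  positiveRow = +-cancelˡ-< i 0 _ (subst₂ _<_ (sym (+-identityʳ i)) j≡ i<j)

  blocked : ∀ i' → i ≡ suc i' → 0 < part μ (suc i) → ¬ (part μ (suc i) + 1 < part μ i) →
            (i , j) ∈ᵈ ν
  blocked i' refl 0<p ¬s =
    ∈ᵈ-intro ν i<j (subst (_≤ i + part ν i) (sym j≡) (+-monoʳ-≤ i μi≤νi))
    where
    below : (suc i , suc i + part μ (suc i)) ∈ᵈ ν
    below = from (spec _)
      ( ∈ᵈ-intro μ (m<m+n (suc i) 0<p) ≤-refl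
      , λ e → 1+n≢n (,-injectiveˡ e))
    μ≤ν : part μ (suc i) ≤ part ν (suc i)
    μ≤ν = +-cancelˡ-≤ (suc i) _ _ (∈ᵈ-≤ ν below)
    μi≤νi : part μ i ≤ part ν i
    μi≤νi = ≤-trans (≮⇒≥ ¬s)
      (subst (_≤ part ν i) (+-comm 1 _)
        (≤-<-trans μ≤ν (partAt-decreasing (parts ν) i' (decreasing ν) (<-≤-trans 0<p μ≤ν))))

  s : Shrinkable (parts μ) i
  s with part μ i ≟ 1 | part μ (suc i) + 1 <? part μ i
  ... | yes e | _ = inj₁ e
  ... | no _  | yes l = inj₂ l
  ... | no n1 | no ¬l with part μ (suc i) in eq
  ...   | zero = ⊥-elim (¬l (≤∧≢⇒< positiveRow (n1 ∘ sym)))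
  ...   | suc p = ⊥-elim (b∉ν (blocked (pred i) (sym (suc-pred i {{>-nonZero (proj₁ (proj₁ h))}}))
                    (subst (0 <_) (sym eq) z<s)
                    (¬l ∘ subst (λ z → z + 1 < part μ i) eq)))

isOuterCorner? : ∀ μ b → Dec (IsOuterCorner μ b)
isOuterCorner? μ b = map′ (cornerCondition⇒isOuterCorner μ b)
                          (isOuterCorner⇒cornerCondition μ b) (cornerCondition? μ b)

------------------------------------------------------------------------

-- The boxes of μ, from the bottom row to the top row.
boxes : StrictPartition → List Box
boxes μ = concatMap (λ i → map (λ t → i , i + suc t) (upTo (part μ i)))
                    (map suc (downFrom (ℓ μ)))

-- An outer corner is the last box of its row, so listing the rows bottom-up
-- lists the corners with strictly decreasing row index.
outerCorners : StrictPartition → List Box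
outerCorners μ = filter (isOuterCorner? μ) (boxes μ)

m : StrictPartition → ℕ
m μ = length (outerCorners μ)

-- (αᵢ , βᵢ) for 1 ≤ i ≤ m
corners : (μ : StrictPartition) → Vec Box (m μ)
corners μ = Vec.fromList (outerCorners μ)

-- α₁ , … , αₘ , αₘ₊₁
αs : (μ : StrictPartition) → Vec ℕ (suc (m μ))
αs μ = Vec.map row (corners μ) ∷ʳ 0

-- β₀ , β₁ , … , βₘ
βs : (μ : StrictPartition) → Vec ℕ (suc (m μ))
βs μ = suc (ℓ μ) ∷ Vec.map col (corners μ)

-- y₁ , … , yₘ
ys : (μ : StrictPartition) → Vec ℕ (m μ)
ys μ = Vec.map content (corners μ)

-- x₀ , … , xₘ.  Since αᵢ₊₁ < βᵢ, the subtraction is never truncated.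
xs : (μ : StrictPartition) → Vec ℕ (suc (m μ))
xs μ = Vec.zipWith _∸_ (βs μ) (αs μ)

x : (μ : StrictPartition) → Fin (suc (m μ)) → ℕ
x μ = Vec.lookup (xs μ)

q : ℕ → StrictPartition → ℤ
q k μ = Vec.sum (Vec.map binomPow (xs μ)) ⊖ Vec.sum (Vec.map binomPow (ys μ))
  where
  binomPow : ℕ → ℕ
  binomPow n = (n C 2) ^ k

-- m = 0 or y₁ > 1
ZeroPlusDefined : ∀ {n} → Vec ℕ n → Set
ZeroPlusDefined []       = ⊤
ZeroPlusDefined (y₁ ∷ _) = y₁ > 1

PlusDefined : (μ : StrictPartition) → Fin (suc (m μ)) → Set
PlusDefined μ zero    = ZeroPlusDefined (ys μ)
PlusDefined μ (suc _) = ⊤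

-- IsPlus μ i ν : μ^{i+} is defined and equal to ν.
IsPlus : (μ : StrictPartition) → Fin (suc (m μ)) → StrictPartition → Set
IsPlus μ i ν =
  PlusDefined μ i ×
  (Σ[ b ∈ Box ] (b ∉ᵈ μ × content b ≡ x μ i × (∀ c → c ∈ᵈ ν ⇔ (c ∈ᵈ μ ⊎ c ≡ b))))

{-# OPTIONS --safe #-}
module Submission where

-- Write f n = C(n,2)ᵏ and Δf n = f (n+1) − f n.  The corner contents telescope along the maximal
-- runs of consecutive parts, so q_k(λ) = f 1 + Σᵣ Δf(λᵣ); as Δf 0 = 0, empty rows may be included
-- in the sum.  Adding a box of content x therefore always raises some λᵣ = x − 1 to x, even when
-- it starts a new row, and changes q_k by Δf x − Δf (x−1) = uᵏ + vᵏ − 2cᵏ, where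
-- u = C(x+1,2), v = C(x−1,2), c = C(x,2).  Since u + v = 2c + 1 and u v = c² − c, this is a
-- polynomial in c, and the leading terms cancel.

open import Defs
open import Algebra.Bundles using (CommutativeRing)
open import Algebra.Definitions.RawMonoid using (sum)
open import Algebra.Properties.Semiring.Sum using (*-distribˡ-sum)
open import Data.Empty using (⊥-elim)
open import Data.Fin using (Fin; toℕ; zero; suc)
open import Data.Integer as ℤ using (ℤ; +_; _-_; 0ℤ; 1ℤ)
import Data.Integer.Properties as ℤₚ
import Data.Integer.Tactic.RingSolver as ℤ-Solver
open import Data.List using (List; []; _∷_; _++_; _∷ʳ_; map; length; upTo; downFrom; applyUpTo; concatMap; filter)
open import Data.List.Properties using (filter-++; filter-none; filter-accept; filter-reject; map-upTo; applyUpTo-∷ʳ)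
open import Data.List.Relation.Unary.All using (All; []; _∷_)
import Data.List.Relation.Unary.All.Properties as All
open import Data.Nat as ℕ using (ℕ; zero; suc; _+_; _∸_; _^_; _≤_; _<_; z≤n; s≤s; z<s; s≤s⁻¹; pred; >-nonZero)
open import Data.Nat.Combinatorics using (_C_; nC1≡n; nCk+nC[k+1]≡[n+1]C[k+1])
import Data.Nat.Coprimality as Coprimality
open import Data.Nat.Properties
import Data.Nat.Tactic.RingSolver as ℕ-Solver
open import Data.Product using (Σ-syntax; _×_; _,_; proj₁; proj₂)
open import Data.Rational as ℚ using (ℚ; mkℚ; _/_; _*_; +-0-rawMonoid)
import Data.Rational.Properties as ℚₚ
open import Data.Sum using (_⊎_; inj₁; inj₂)
import Data.Vec as Vec
open import Level using (0ℓ)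
open import Function using (_∘_)
open import Function.Bundles using (_⇔_; Equivalence)
open import Relation.Binary.PropositionalEquality using (_≡_; _≢_; refl; sym; trans; cong; cong₂; subst; module ≡-Reasoning)
open import Relation.Nullary using (¬_; Dec; yes; no)
open import Relation.Unary using (Pred; Decidable)

open Equivalence using (to; from)

-- Integer polynomials with a bounded number of coefficients.

-- A Horner scheme with integer coefficients, read off from the constant term. The index is an upper
-- bound on the number of coefficients, so leading zeros are allowed. The equations are pointwise,
-- so a function qualifies however it is written, without function extensionality.
data PolynomialBelow : ℕ → (ℤ → ℤ) → Set where
  vanishing : ∀ {g} → (∀ c → g c ≡ 0ℤ) → PolynomialBelow 0 g
  horner    : ∀ {k g} a {h} → PolynomialBelow k h → (∀ c → g c ≡ a ℤ.+ c ℤ.* h c) →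
              PolynomialBelow (suc k) g

polynomial-cong : ∀ {k f g} → (∀ c → g c ≡ f c) → PolynomialBelow k f → PolynomialBelow k g
polynomial-cong e (vanishing z)  = vanishing λ c → trans (e c) (z c)
polynomial-cong e (horner a p s) = horner a p λ c → trans (e c) (s c)

polynomial-0 : ∀ k → PolynomialBelow k (λ _ → 0ℤ)
polynomial-0 zero    = vanishing λ _ → refl
polynomial-0 (suc k) = horner 0ℤ (polynomial-0 k) eq
  where
  eq : ∀ c → 0ℤ ≡ 0ℤ ℤ.+ c ℤ.* 0ℤ
  eq = ℤ-Solver.solve-∀

polynomial-suc : ∀ {k g} → PolynomialBelow k g → PolynomialBelow (suc k) g
polynomial-suc (vanishing z)  = polynomial-cong z (polynomial-0 1)
polynomial-suc (horner a p s) = horner a (polynomial-suc p) s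

polynomial-+ : ∀ {k f g} → PolynomialBelow k f → PolynomialBelow k g →
               PolynomialBelow k (λ c → f c ℤ.+ g c)
polynomial-+ (vanishing y) (vanishing z) = vanishing λ c → cong₂ ℤ._+_ (y c) (z c)
polynomial-+ (horner a {h} p s) (horner b {h′} p′ s′) =
  horner (a ℤ.+ b) (polynomial-+ p p′)
    λ c → trans (cong₂ ℤ._+_ (s c) (s′ c)) (eq a b c (h c) (h′ c))
  where
  eq : ∀ a b c u v → a ℤ.+ c ℤ.* u ℤ.+ (b ℤ.+ c ℤ.* v) ≡ a ℤ.+ b ℤ.+ c ℤ.* (u ℤ.+ v)
  eq = ℤ-Solver.solve-∀

polynomial-scale : ∀ {k g} b → PolynomialBelow k g → PolynomialBelow k (λ c → b ℤ.* g c)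
polynomial-scale b (vanishing z) = vanishing λ c → trans (cong (b ℤ.*_) (z c)) (ℤₚ.*-zeroʳ b)
polynomial-scale b (horner a {h} p s) =
  horner (b ℤ.* a) (polynomial-scale b p) λ c → trans (cong (b ℤ.*_) (s c)) (eq a b c (h c))
  where
  eq : ∀ a b c u → b ℤ.* (a ℤ.+ c ℤ.* u) ≡ b ℤ.* a ℤ.+ c ℤ.* (b ℤ.* u)
  eq = ℤ-Solver.solve-∀

polynomial-shift : ∀ {k g} → PolynomialBelow k g → PolynomialBelow (suc k) (λ c → c ℤ.* g c)
polynomial-shift p = horner 0ℤ p λ c → sym (ℤₚ.+-identityˡ _)

polynomial-^ : ∀ k → PolynomialBelow (suc k) (ℤ._^ k)
polynomial-^ zero    = horner 1ℤ (polynomial-0 0) eq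
  where
  eq : ∀ c → 1ℤ ≡ 1ℤ ℤ.+ c ℤ.* 0ℤ
  eq = ℤ-Solver.solve-∀
polynomial-^ (suc k) = polynomial-shift (polynomial-^ k)

-- Power sums of the two neighbouring binomials.

-- If u + v = 2c + 1 and u v = c² − c, this is uᵏ + vᵏ − 2cᵏ as a polynomial in c:
-- the power sums of u and v satisfy the linear recurrence with these coefficients.
D : ℕ → ℤ → ℤ
D 0             c = 0ℤ
D 1             c = 1ℤ
D (suc (suc k)) c = (c ℤ.+ c ℤ.+ 1ℤ) ℤ.* D (suc k) c - (c ℤ.* c - c) ℤ.* D k c ℤ.+ + 4 ℤ.* (c ℤ.* c ℤ.^ k)

-- The cancellation of the leading terms is built into the starting values: `D 0` has no coefficient
-- and `D 1` has one. The recurrence preserves the bound, since `c * D (suc k)`, `c * c * D k` and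
-- `c ^ suc k` all have at most `suc (suc k)` coefficients.
D-polynomial : ∀ k → PolynomialBelow k (D k)
D-polynomial 0             = polynomial-0 0
D-polynomial 1             = polynomial-^ 0
D-polynomial (suc (suc k)) = step (D-polynomial (suc k)) (D-polynomial k)
  where
  -- The closure lemmas multiply only by constants and by `c`, so the quadratic coefficient of the
  -- recurrence is expanded into iterated shifts.
  eq : ∀ c x y z →
       (c ℤ.+ c ℤ.+ 1ℤ) ℤ.* x - (c ℤ.* c - c) ℤ.* y ℤ.+ + 4 ℤ.* z
       ≡ c ℤ.* (+ 2 ℤ.* x) ℤ.+ x ℤ.+ (c ℤ.* (c ℤ.* (ℤ.- 1ℤ ℤ.* y)) ℤ.+ c ℤ.* y) ℤ.+ + 4 ℤ.* z
  eq = ℤ-Solver.solve-∀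
  step : PolynomialBelow (suc k) (D (suc k)) → PolynomialBelow k (D k) →
         PolynomialBelow (suc (suc k)) (D (suc (suc k)))
  step d₁ d₀ = polynomial-cong (λ c → eq c (D (suc k) c) (D k c) (c ℤ.* c ℤ.^ k))
    (polynomial-+
      (polynomial-+
        (polynomial-+ (polynomial-shift (polynomial-scale (+ 2) d₁)) (polynomial-suc d₁))
        (polynomial-+ (polynomial-shift (polynomial-shift (polynomial-scale (ℤ.- 1ℤ) d₀)))
                      (polynomial-shift (polynomial-suc d₀))))
      (polynomial-scale (+ 4) (polynomial-^ (suc k))))

-- As roots of X² - sX + p, with s = u + v and p = u v, both `u` and `v` have powers obeying the
-- recurrence. The powers of `c` do not: their defect is twice (s c - p - c²) cᵏ = 2 c cᵏ, which
-- produces the inhomogeneous term 4 c cᵏ of `D`.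
powerSum≡D : ∀ {u v c} → u ℤ.+ v ≡ c ℤ.+ c ℤ.+ 1ℤ → u ℤ.* v ≡ c ℤ.* c - c →
             ∀ k → u ℤ.^ k ℤ.+ v ℤ.^ k - (c ℤ.^ k ℤ.+ c ℤ.^ k) ≡ D k c
powerSum≡D {u} {v} {c} u+v uv 0 = refl
powerSum≡D {u} {v} {c} u+v uv 1 = begin
  u ℤ.* 1ℤ ℤ.+ v ℤ.* 1ℤ - (c ℤ.* 1ℤ ℤ.+ c ℤ.* 1ℤ) ≡⟨ eq u v c ⟩
  u ℤ.+ v - (c ℤ.+ c)                              ≡⟨ cong (_- (c ℤ.+ c)) u+v ⟩
  c ℤ.+ c ℤ.+ 1ℤ - (c ℤ.+ c)                       ≡⟨ eq′ c ⟩
  1ℤ                                               ∎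
  where
  open ≡-Reasoning
  eq : ∀ u v c → u ℤ.* 1ℤ ℤ.+ v ℤ.* 1ℤ - (c ℤ.* 1ℤ ℤ.+ c ℤ.* 1ℤ) ≡ u ℤ.+ v - (c ℤ.+ c)
  eq = ℤ-Solver.solve-∀
  eq′ : ∀ c → c ℤ.+ c ℤ.+ 1ℤ - (c ℤ.+ c) ≡ 1ℤ
  eq′ = ℤ-Solver.solve-∀
powerSum≡D {u} {v} {c} u+v uv (suc (suc k)) = begin
  u ℤ.* (u ℤ.* U) ℤ.+ v ℤ.* (v ℤ.* V) - (c ℤ.* (c ℤ.* W) ℤ.+ c ℤ.* (c ℤ.* W))
    ≡⟨ eq u v U V c W ⟩
  (u ℤ.+ v) ℤ.* S₁ - u ℤ.* v ℤ.* S₀ ℤ.+ + 2 ℤ.* ((u ℤ.+ v) ℤ.* (c ℤ.* W) - u ℤ.* v ℤ.* W - c ℤ.* (c ℤ.* W))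
    ≡⟨ cong₂ (λ s p → s ℤ.* S₁ - p ℤ.* S₀ ℤ.+ + 2 ℤ.* (s ℤ.* (c ℤ.* W) - p ℤ.* W - c ℤ.* (c ℤ.* W))) u+v uv ⟩
  s ℤ.* S₁ - p ℤ.* S₀ ℤ.+ + 2 ℤ.* (s ℤ.* (c ℤ.* W) - p ℤ.* W - c ℤ.* (c ℤ.* W))
    ≡⟨ cong₂ ℤ._+_ (cong₂ (λ d₁ d₀ → s ℤ.* d₁ - p ℤ.* d₀) (powerSum≡D {u} {v} {c} u+v uv (suc k))
                                                             (powerSum≡D {u} {v} {c} u+v uv k))
                   (eq′ c W) ⟩
  s ℤ.* D (suc k) c - p ℤ.* D k c ℤ.+ + 4 ℤ.* (c ℤ.* W) ∎
  where
  open ≡-Reasoning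
  U = u ℤ.^ k
  V = v ℤ.^ k
  W = c ℤ.^ k
  s = c ℤ.+ c ℤ.+ 1ℤ
  p = c ℤ.* c - c
  S₁ = u ℤ.* U ℤ.+ v ℤ.* V - (c ℤ.* W ℤ.+ c ℤ.* W)
  S₀ = U ℤ.+ V - (W ℤ.+ W)
  eq : ∀ u v U V c W →
       u ℤ.* (u ℤ.* U) ℤ.+ v ℤ.* (v ℤ.* V) - (c ℤ.* (c ℤ.* W) ℤ.+ c ℤ.* (c ℤ.* W))
       ≡ (u ℤ.+ v) ℤ.* (u ℤ.* U ℤ.+ v ℤ.* V - (c ℤ.* W ℤ.+ c ℤ.* W)) - u ℤ.* v ℤ.* (U ℤ.+ V - (W ℤ.+ W))
         ℤ.+ + 2 ℤ.* ((u ℤ.+ v) ℤ.* (c ℤ.* W) - u ℤ.* v ℤ.* W - c ℤ.* (c ℤ.* W))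
  eq = ℤ-Solver.solve-∀
  eq′ : ∀ c W → + 2 ℤ.* ((c ℤ.+ c ℤ.+ 1ℤ) ℤ.* (c ℤ.* W) - (c ℤ.* c - c) ℤ.* W - c ℤ.* (c ℤ.* W))
        ≡ + 4 ℤ.* (c ℤ.* W)
  eq′ = ℤ-Solver.solve-∀

-- Second differences of powers of binomial coefficients.

[1+n]C2≡n+nC2 : ∀ n → suc n C 2 ≡ n + n C 2
[1+n]C2≡n+nC2 n = trans (sym (nCk+nC[k+1]≡[n+1]C[k+1] n 1)) (cong (_+ n C 2) (nC1≡n n))

2*[1+n]C2≡[1+n]*n : ∀ n → suc n C 2 + suc n C 2 ≡ suc n ℕ.* n
2*[1+n]C2≡[1+n]*n zero    = refl
2*[1+n]C2≡[1+n]*n (suc n) = begin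
  suc (suc n) C 2 + suc (suc n) C 2             ≡⟨ cong₂ _+_ e e ⟩
  suc n + suc n C 2 + (suc n + suc n C 2)       ≡⟨ eq (suc n) (suc n C 2) ⟩
  suc n + suc n + (suc n C 2 + suc n C 2)       ≡⟨ cong (λ t → suc n + suc n + t) (2*[1+n]C2≡[1+n]*n n) ⟩
  suc n + suc n + suc n ℕ.* n                   ≡⟨ eq′ n ⟩
  suc (suc n) ℕ.* suc n                         ∎
  where
  open ≡-Reasoning
  e = [1+n]C2≡n+nC2 (suc n)
  eq : ∀ a b → a + b + (a + b) ≡ a + a + (b + b)
  eq = ℕ-Solver.solve-∀
  eq′ : ∀ n → suc n + suc n + suc n ℕ.* n ≡ suc (suc n) ℕ.* suc n
  eq′ = ℕ-Solver.solve-∀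

pos-^ : ∀ n k → + (n ^ k) ≡ (+ n) ℤ.^ k
pos-^ n zero    = refl
pos-^ n (suc k) = trans (ℤₚ.pos-* n (n ^ k)) (cong (+ n ℤ.*_) (pos-^ n k))

binom₂^ : ℕ → ℕ → ℕ
binom₂^ k n = (n C 2) ^ k

Δ : (ℕ → ℕ) → ℕ → ℤ
Δ f n = + f (suc n) - + f n

-- With u = c + n + 1 and v = c - n the sum is 2c + 1, and the product is c² + c - n(n + 1), where
-- n(n + 1) = 2c.
Δ²-binom₂^ : ∀ k n → Δ (binom₂^ k) (suc n) - Δ (binom₂^ k) n ≡ D k (+ (suc n C 2))
Δ²-binom₂^ k n = begin
  Δ (binom₂^ k) (suc n) - Δ (binom₂^ k) n
    ≡⟨ eq (+ binom₂^ k (suc (suc n))) (+ binom₂^ k n) (+ binom₂^ k (suc n)) ⟩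
  + binom₂^ k (suc (suc n)) ℤ.+ + binom₂^ k n - (+ binom₂^ k (suc n) ℤ.+ + binom₂^ k (suc n))
    ≡⟨ cong₂ _-_ (cong₂ ℤ._+_ (pos-^ (suc (suc n) C 2) k) (pos-^ (n C 2) k))
                 (cong₂ ℤ._+_ (pos-^ (suc n C 2) k) (pos-^ (suc n C 2) k)) ⟩
  u ℤ.^ k ℤ.+ v ℤ.^ k - (c ℤ.^ k ℤ.+ c ℤ.^ k)
    ≡⟨ powerSum≡D {u} {v} {c} u+v uv k ⟩
  D k c ∎
  where
  open ≡-Reasoning
  u = + (suc (suc n) C 2)
  v = + (n C 2)
  c = + (suc n C 2)
  t = + n
  eq : ∀ a b d → a - d - (d - b) ≡ a ℤ.+ b - (d ℤ.+ d)
  eq = ℤ-Solver.solve-∀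
  u≡ : u ≡ 1ℤ ℤ.+ t ℤ.+ c
  u≡ = trans (cong +_ ([1+n]C2≡n+nC2 (suc n))) (ℤₚ.pos-+ (suc n) (suc n C 2))
  c≡ : c ≡ t ℤ.+ v
  c≡ = trans (cong +_ ([1+n]C2≡n+nC2 n)) (ℤₚ.pos-+ n (n C 2))
  2c≡ : c ℤ.+ c ≡ (1ℤ ℤ.+ t) ℤ.* t
  2c≡ = trans (sym (ℤₚ.pos-+ (suc n C 2) (suc n C 2)))
          (trans (cong +_ (2*[1+n]C2≡[1+n]*n n)) (ℤₚ.pos-* (suc n) n))
  u+v : u ℤ.+ v ≡ c ℤ.+ c ℤ.+ 1ℤ
  u+v = trans (cong (ℤ._+ v) u≡) (trans (e₁ t c v) (cong (λ z → c ℤ.+ z ℤ.+ 1ℤ) (sym c≡)))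
    where
    e₁ : ∀ t c v → 1ℤ ℤ.+ t ℤ.+ c ℤ.+ v ≡ c ℤ.+ (t ℤ.+ v) ℤ.+ 1ℤ
    e₁ = ℤ-Solver.solve-∀
  v≡ : v ≡ c - t
  v≡ = trans (e₂ t v) (cong (_- t) (sym c≡))
    where
    e₂ : ∀ t v → v ≡ t ℤ.+ v - t
    e₂ = ℤ-Solver.solve-∀
  uv : u ℤ.* v ≡ c ℤ.* c - c
  uv = trans (cong₂ ℤ._*_ u≡ v≡)
         (trans (e₃ t c) (trans (cong (λ z → c ℤ.* c ℤ.+ c - z) (sym 2c≡)) (e₄ c)))
    where
    e₃ : ∀ t c → (1ℤ ℤ.+ t ℤ.+ c) ℤ.* (c - t) ≡ c ℤ.* c ℤ.+ c - (1ℤ ℤ.+ t) ℤ.* t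
    e₃ = ℤ-Solver.solve-∀
    e₄ : ∀ c → c ℤ.* c ℤ.+ c - (c ℤ.+ c) ≡ c ℤ.* c - c
    e₄ = ℤ-Solver.solve-∀

-- Passage to rational coefficients.

-- `_/_` normalises by a gcd and is stuck on a variable numerator. In the `mkℚ` form, sums and
-- products of such fractions compute.
/1≡mkℚ : ∀ i → i / 1 ≡ mkℚ i 0 (Coprimality.sym (Coprimality.1-coprimeTo ℤ.∣ i ∣))
/1≡mkℚ i = ℚₚ.↥p/↧p≡p (mkℚ i 0 (Coprimality.sym (Coprimality.1-coprimeTo ℤ.∣ i ∣)))

/1-homo-+ : ∀ i j → (i ℤ.+ j) / 1 ≡ i / 1 ℚ.+ j / 1
/1-homo-+ i j = sym (trans (cong₂ ℚ._+_ (/1≡mkℚ i) (/1≡mkℚ j))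
  (cong (_/ 1) (cong₂ ℤ._+_ (ℤₚ.*-identityʳ i) (ℤₚ.*-identityʳ j))))

/1-homo-* : ∀ i j → (i ℤ.* j) / 1 ≡ i / 1 * (j / 1)
/1-homo-* i j = sym (cong₂ _*_ (/1≡mkℚ i) (/1≡mkℚ j))

-- The outermost Horner constant is the coefficient of exponent 0, and the inner scheme supplies the
-- others with exponents raised by one. This matches the way `sum` over `Fin (suc k)` unfolds.
-- Arguments are natural numbers because the powers to be matched are taken in `ℕ`.
polynomialCoefficients : ∀ {k g} → PolynomialBelow k g → Σ[ ξ ∈ (Fin k → ℚ) ]
  (∀ n → g (+ n) / 1 ≡ sum +-0-rawMonoid (λ j → ξ j * ((+ (n ^ toℕ j)) / 1)))
polynomialCoefficients (vanishing z) = (λ ()) , λ n → cong (_/ 1) (z (+ n))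
polynomialCoefficients {g = g} (horner {k} a {h} p s) with polynomialCoefficients p
... | ξ , eq = ξ′ , λ n → begin
  g (+ n) / 1                                                ≡⟨ cong (_/ 1) (s (+ n)) ⟩
  (a ℤ.+ + n ℤ.* h (+ n)) / 1                                ≡⟨ /1-homo-+ a (+ n ℤ.* h (+ n)) ⟩
  a / 1 ℚ.+ (+ n ℤ.* h (+ n)) / 1
    ≡⟨ cong₂ ℚ._+_ (sym (ℚₚ.*-identityʳ (a / 1))) (/1-homo-* (+ n) (h (+ n))) ⟩
  a / 1 * ((+ 1) / 1) ℚ.+ (+ n) / 1 * (h (+ n) / 1)
    ≡⟨ cong (λ z → a / 1 * ((+ 1) / 1) ℚ.+ (+ n) / 1 * z) (eq n) ⟩
  a / 1 * ((+ 1) / 1) ℚ.+ (+ n) / 1 * sum +-0-rawMonoid (λ j → ξ j * ((+ (n ^ toℕ j)) / 1))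
    ≡⟨ cong (λ z → a / 1 * ((+ 1) / 1) ℚ.+ z) (distrib n) ⟩
  sum +-0-rawMonoid (λ j → ξ′ j * ((+ (n ^ toℕ j)) / 1))     ∎
  where
  open ≡-Reasoning
  open import Algebra.Properties.Monoid.Sum ℚₚ.+-0-monoid using (sum-cong-≗)
  ξ′ : Fin (suc k) → ℚ
  ξ′ zero    = a / 1
  ξ′ (suc j) = ξ j
  term : ∀ n j → (+ n) / 1 * (ξ j * ((+ (n ^ toℕ j)) / 1)) ≡ ξ j * ((+ (n ^ suc (toℕ j))) / 1)
  term n j = begin
    N * (ξ j * M)                         ≡⟨ sym (ℚₚ.*-assoc N (ξ j) M) ⟩
    N * ξ j * M                           ≡⟨ cong (_* M) (ℚₚ.*-comm N (ξ j)) ⟩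
    ξ j * N * M                           ≡⟨ ℚₚ.*-assoc (ξ j) N M ⟩
    ξ j * (N * M)                         ≡⟨ cong (ξ j *_) (sym (/1-homo-* (+ n) (+ (n ^ toℕ j)))) ⟩
    ξ j * ((+ n ℤ.* + (n ^ toℕ j)) / 1)   ≡⟨ cong (λ z → ξ j * (z / 1)) (sym (ℤₚ.pos-* n (n ^ toℕ j))) ⟩
    ξ j * ((+ (n ^ suc (toℕ j))) / 1)     ∎
    where
    N = (+ n) / 1
    M = (+ (n ^ toℕ j)) / 1
  distrib : ∀ n → (+ n) / 1 * sum +-0-rawMonoid (λ j → ξ j * ((+ (n ^ toℕ j)) / 1))
                ≡ sum +-0-rawMonoid (λ j → ξ j * ((+ (n ^ suc (toℕ j))) / 1))
  distrib n = trans
    (*-distribˡ-sum (CommutativeRing.semiring ℚₚ.+-*-commutativeRing) ((+ n) / 1) (λ j → ξ j * ((+ (n ^ toℕ j)) / 1)))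
    (sum-cong-≗ (term n))

-- Sums over the rows of a diagram.

rowSum : (ℕ → ℤ) → ℕ → ℤ
rowSum h zero    = 0ℤ
rowSum h (suc n) = rowSum h n ℤ.+ h (suc n)

rowSum-cong : ∀ {h h′} n → (∀ r → r ≤ n → h′ r ≡ h r) → rowSum h′ n ≡ rowSum h n
rowSum-cong zero    e = refl
rowSum-cong (suc n) e = cong₂ ℤ._+_ (rowSum-cong n λ r r≤n → e r (m≤n⇒m≤1+n r≤n)) (e (suc n) ≤-refl)

-- This allows partitions of different lengths to be compared over one common range of rows.
rowSum-extend : ∀ {h} n → (∀ r → n < r → h r ≡ 0ℤ) → ∀ d → rowSum h (d + n) ≡ rowSum h n
rowSum-extend     n z zero    = refl
rowSum-extend {h} n z (suc d) =
  trans (cong₂ ℤ._+_ (rowSum-extend {h} n z d) (z (suc (d + n)) (s≤s (m≤n+m n d)))) (ℤₚ.+-identityʳ _)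

rowSum-update : ∀ {h h′} n r₀ → 1 ≤ r₀ → r₀ ≤ n → (∀ r → r ≢ r₀ → h′ r ≡ h r) →
                rowSum h′ n - rowSum h n ≡ h′ r₀ - h r₀
rowSum-update zero (suc _) _ () e
rowSum-update {h} {h′} (suc n) r₀ 1≤r₀ r₀≤ e with m≤n⇒m<n∨m≡n r₀≤
... | inj₁ r₀<1+n = begin
  rowSum h′ n ℤ.+ h′ (suc n) - (rowSum h n ℤ.+ h (suc n))
    ≡⟨ cong (λ z → rowSum h′ n ℤ.+ z - (rowSum h n ℤ.+ h (suc n))) (e (suc n) λ { refl → <-irrefl refl r₀<1+n }) ⟩
  rowSum h′ n ℤ.+ h (suc n) - (rowSum h n ℤ.+ h (suc n)) ≡⟨ eq (rowSum h′ n) (h (suc n)) (rowSum h n) ⟩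
  rowSum h′ n - rowSum h n                               ≡⟨ rowSum-update n r₀ 1≤r₀ (s≤s⁻¹ r₀<1+n) e ⟩
  h′ r₀ - h r₀                                           ∎
  where
  open ≡-Reasoning
  eq : ∀ a b d → a ℤ.+ b - (d ℤ.+ b) ≡ a - d
  eq = ℤ-Solver.solve-∀
... | inj₂ refl =
  trans (cong (λ z → z ℤ.+ h′ (suc n) - (rowSum h n ℤ.+ h (suc n)))
          (rowSum-cong n λ r r≤n → e r λ { refl → <-irrefl refl r≤n }))
    (eq (h′ (suc n)) (h (suc n)) (rowSum h n))
  where
  eq : ∀ a b d → d ℤ.+ a - (d ℤ.+ b) ≡ a - b
  eq = ℤ-Solver.solve-∀

-- Outer corners and the telescoping formula for `q`.

part-beyond-ℓ : ∀ μ r → ℓ μ < r → part μ r ≡ 0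
part-beyond-ℓ μ r ℓ<r with part μ r in eq
... | zero  = refl
... | suc _ = ⊥-elim (<⇒≱ ℓ<r (proj₂ (partAt>0⇒row (parts μ) r (subst (0 <_) (sym eq) z<s))))

partAt>0 : ∀ {ps} → All (0 <_) ps → ∀ r → r < length ps → 0 < partAt ps (suc r)
partAt>0 (0<p ∷ ap) zero    _          = 0<p
partAt>0 (0<p ∷ ap) (suc r) (s≤s r<n)  = partAt>0 ap r r<n

filter-applyUpTo-last : ∀ {A : Set} {P : Pred A 0ℓ} (P? : Decidable P) (f : ℕ → A) n →
                        (∀ {t} → t < n → ¬ P (f t)) →
                        filter P? (applyUpTo f (suc n)) ≡ filter P? (f n ∷ [])
filter-applyUpTo-last P? f n ¬P = begin
  filter P? (applyUpTo f (suc n))                    ≡⟨ cong (filter P?) (sym (applyUpTo-∷ʳ f n)) ⟩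
  filter P? (applyUpTo f n ∷ʳ f n)                   ≡⟨ filter-++ P? (applyUpTo f n) (f n ∷ []) ⟩
  filter P? (applyUpTo f n) ++ filter P? (f n ∷ [])
    ≡⟨ cong (_++ filter P? (f n ∷ [])) (filter-none P? (All.applyUpTo⁺₁ f n ¬P)) ⟩
  filter P? (f n ∷ [])                               ∎
  where open ≡-Reasoning

rowBoxes : StrictPartition → ℕ → List Box
rowBoxes μ i = map (λ t → i , i + suc t) (upTo (part μ i))

-- The corners in the top `N` rows, kept in bottom-up order so that induction on `N` peels off the
-- head. For `N = ℓ μ` this unfolds to `outerCorners μ`.
cornersUpToRow : StrictPartition → ℕ → List Box
cornersUpToRow μ N = filter (isOuterCorner? μ) (concatMap (rowBoxes μ) (map suc (downFrom N)))

filter-rowBoxes : ∀ μ i n → part μ i ≡ suc n →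
                  filter (isOuterCorner? μ) (rowBoxes μ i) ≡ filter (isOuterCorner? μ) ((i , i + part μ i) ∷ [])
filter-rowBoxes μ i n eq = begin
  filter P? (map f (upTo (part μ i)))    ≡⟨ cong (filter P?) (map-upTo f (part μ i)) ⟩
  filter P? (applyUpTo f (part μ i))     ≡⟨ cong (filter P? ∘ applyUpTo f) eq ⟩
  filter P? (applyUpTo f (suc n))        ≡⟨ filter-applyUpTo-last P? f n notLast ⟩
  filter P? (f n ∷ [])                   ≡⟨ cong (λ z → filter P? ((i , i + z) ∷ [])) (sym eq) ⟩
  filter P? ((i , i + part μ i) ∷ [])    ∎
  where
  open ≡-Reasoning
  P? = isOuterCorner? μ
  f : ℕ → Box
  f t = i , i + suc t
  notLast : ∀ {t} → t < n → ¬ IsOuterCorner μ (f t)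
  notLast {t} t<n c with isOuterCorner⇒cornerCondition μ (f t) c
  ... | (_ , e) , _ = <⇒≢ t<n (suc-injective (trans (+-cancelˡ-≡ i (suc t) _ e) eq))

-- Failure of the second alternative of `Shrinkable` gives the upper bound, and strict decrease
-- gives the lower one. If the next part is 0, positivity of the parts takes the place of strict
-- decrease.
¬shrinkable⇒consecutive : ∀ μ i → i < ℓ μ → ¬ Shrinkable (parts μ) (suc i) →
                          part μ (suc i) ≡ suc (part μ (suc (suc i)))
¬shrinkable⇒consecutive μ i i<ℓ ¬s = ≤-antisym
  (subst (part μ (suc i) ≤_) (+-comm _ 1) (≮⇒≥ (¬s ∘ inj₂))) (lower _ refl)
  where
  lower : ∀ p → part μ (suc (suc i)) ≡ p → p < part μ (suc i)
  lower zero    eq = partAt>0 (positive μ) i i<ℓ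
  lower (suc p) eq = subst (_< part μ (suc i)) eq
    (partAt-decreasing (parts μ) i (decreasing μ) (subst (0 <_) (sym eq) z<s))

-- The expression defining `q`, with an arbitrary `f`, an arbitrary corner list and a free initial
-- column `β` in place of β₀. Freeing `β` makes the tail of a corner list an instance of the same
-- expression.
cornerSum : (ℕ → ℕ) → ℕ → List Box → ℤ
cornerSum f β C =
  + Vec.sum (Vec.map f (Vec.zipWith _∸_ (β Vec.∷ Vec.map col (Vec.fromList C))
                                        (Vec.map row (Vec.fromList C) Vec.∷ʳ 0)))
  - + Vec.sum (Vec.map f (Vec.map content (Vec.fromList C)))

-- The initial column is paired with the row of the first corner, which gives an inner corner
-- content; the column of that corner then becomes the new initial column.
cornerSum-∷ : ∀ f β b C → cornerSum f β (b ∷ C) ≡ + f (β ∸ row b) - + f (content b) ℤ.+ cornerSum f (col b) C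
cornerSum-∷ f β b C = trans (cong₂ _-_ (ℤₚ.pos-+ (f (β ∸ row b)) X) (ℤₚ.pos-+ (f (content b)) Y))
  (eq (+ f (β ∸ row b)) (+ X) (+ f (content b)) (+ Y))
  where
  X = Vec.sum (Vec.map f (Vec.zipWith _∸_ (col b Vec.∷ Vec.map col (Vec.fromList C))
                                          (Vec.map row (Vec.fromList C) Vec.∷ʳ 0)))
  Y = Vec.sum (Vec.map f (Vec.map content (Vec.fromList C)))
  eq : ∀ a x b y → a ℤ.+ x - (b ℤ.+ y) ≡ a - b ℤ.+ (x - y)
  eq = ℤ-Solver.solve-∀

-- Each maximal run of consecutive part sizes contributes f (largest + 1) − f (smallest),
-- which telescopes over the rows of the run.
cornerSum-cornersUpToRow : ∀ f μ N → N ≤ ℓ μ →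
  cornerSum f (N + suc (part μ (suc N))) (cornersUpToRow μ N)
  ≡ + f (suc (part μ (suc N))) ℤ.+ rowSum (Δ f ∘ part μ) N
-- Without corners, the initial column is paired with the closing 0 of the row list, so the single
-- inner content is `suc (part μ 1)`.
cornerSum-cornersUpToRow f μ zero N≤ℓ =
  cong (λ z → + z - 0ℤ) (+-identityʳ (f (suc (part μ 1))))
cornerSum-cornersUpToRow f μ (suc N) N<ℓ = go (isOuterCorner? μ b)
  where
  open ≡-Reasoning
  i = suc N
  p = part μ i
  p′ = part μ (suc i)
  b : Box
  b = i , i + p
  0<p : 0 < p
  0<p = partAt>0 (positive μ) N N<ℓ
  IH = cornerSum-cornersUpToRow f μ N (<⇒≤ N<ℓ)
  unfold : cornersUpToRow μ i ≡ filter (isOuterCorner? μ) (b ∷ []) ++ cornersUpToRow μ N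
  unfold = trans (filter-++ (isOuterCorner? μ) (rowBoxes μ i) _)
    (cong (_++ cornersUpToRow μ N)
      (filter-rowBoxes μ i (pred p) (sym (suc-pred p {{>-nonZero 0<p}}))))

  go : Dec (IsOuterCorner μ b) →
       cornerSum f (i + suc p′) (cornersUpToRow μ i) ≡ + f (suc p′) ℤ.+ rowSum (Δ f ∘ part μ) i
  go (yes c) = begin
    cornerSum f (i + suc p′) (cornersUpToRow μ i)
      ≡⟨ cong (cornerSum f (i + suc p′))
           (trans unfold (cong (_++ cornersUpToRow μ N) (filter-accept (isOuterCorner? μ) {b} {[]} c))) ⟩
    cornerSum f (i + suc p′) (b ∷ cornersUpToRow μ N)
      ≡⟨ cornerSum-∷ f (i + suc p′) b (cornersUpToRow μ N) ⟩
    + f (i + suc p′ ∸ i) - + f (i + p ∸ i) ℤ.+ cornerSum f (i + p) (cornersUpToRow μ N)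
      ≡⟨ cong₂ (λ y z → + f y - + f z ℤ.+ cornerSum f (i + p) (cornersUpToRow μ N))
           (m+n∸m≡n i (suc p′)) (m+n∸m≡n i p) ⟩
    + f (suc p′) - + f p ℤ.+ cornerSum f (i + p) (cornersUpToRow μ N)
      -- As `i = suc N`, the column `i + p` of the corner is exactly the initial column in the
      -- induction hypothesis.
      ≡⟨ cong (λ z → + f (suc p′) - + f p ℤ.+ cornerSum f z (cornersUpToRow μ N)) (sym (+-suc N p)) ⟩
    + f (suc p′) - + f p ℤ.+ cornerSum f (N + suc p) (cornersUpToRow μ N)
      ≡⟨ cong (λ z → + f (suc p′) - + f p ℤ.+ z) IH ⟩
    + f (suc p′) - + f p ℤ.+ (+ f (suc p) ℤ.+ rowSum (Δ f ∘ part μ) N)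
      ≡⟨ eq (+ f (suc p′)) (+ f p) (+ f (suc p)) (rowSum (Δ f ∘ part μ) N) ⟩
    + f (suc p′) ℤ.+ rowSum (Δ f ∘ part μ) i ∎
    where
    eq : ∀ a b d s → a - b ℤ.+ (d ℤ.+ s) ≡ a ℤ.+ (s ℤ.+ (d - b))
    eq = ℤ-Solver.solve-∀
  go (no ¬c) = begin
    cornerSum f (i + suc p′) (cornersUpToRow μ i)
      ≡⟨ cong (cornerSum f (i + suc p′))
           (trans unfold (cong (_++ cornersUpToRow μ N) (filter-reject (isOuterCorner? μ) {b} {[]} ¬c))) ⟩
    cornerSum f (i + suc p′) (cornersUpToRow μ N)
      -- Inside a run `p = suc p′`, so consecutive rows end in the same column and the initial
      -- column is unchanged.
      ≡⟨ cong (λ z → cornerSum f z (cornersUpToRow μ N))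
           (trans (sym (+-suc N (suc p′))) (cong (λ z → N + suc z) (sym p≡))) ⟩
    cornerSum f (N + suc p) (cornersUpToRow μ N)
      ≡⟨ IH ⟩
    + f (suc p) ℤ.+ rowSum (Δ f ∘ part μ) N
      ≡⟨ eq (+ f (suc p)) (+ f p) (rowSum (Δ f ∘ part μ) N) ⟩
    + f p ℤ.+ rowSum (Δ f ∘ part μ) i
      ≡⟨ cong (λ z → + f z ℤ.+ rowSum (Δ f ∘ part μ) i) p≡ ⟩
    + f (suc p′) ℤ.+ rowSum (Δ f ∘ part μ) i ∎
    where
    p≡ : p ≡ suc p′
    p≡ = ¬shrinkable⇒consecutive μ N N<ℓ λ s →
      ¬c (cornerCondition⇒isOuterCorner μ b ((m<m+n i 0<p , refl) , s))
    eq : ∀ a b s → a ℤ.+ s ≡ b ℤ.+ (s ℤ.+ (a - b))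
    eq = ℤ-Solver.solve-∀

q≡rowSum : ∀ k μ → q k μ ≡ + binom₂^ k 1 ℤ.+ rowSum (Δ (binom₂^ k) ∘ part μ) (ℓ μ)
q≡rowSum k μ = begin
  q k μ
    ≡⟨ sym (ℤₚ.m-n≡m⊖n (Vec.sum (Vec.map (binom₂^ k) (xs μ))) (Vec.sum (Vec.map (binom₂^ k) (ys μ)))) ⟩
  cornerSum (binom₂^ k) (suc (ℓ μ)) (outerCorners μ)             ≡⟨ subst Goal beyond eq ⟩
  + binom₂^ k 1 ℤ.+ rowSum (Δ (binom₂^ k) ∘ part μ) (ℓ μ)        ∎
  where
  open ≡-Reasoning
  beyond : part μ (suc (ℓ μ)) ≡ 0
  beyond = part-beyond-ℓ μ (suc (ℓ μ)) ≤-refl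
  -- The initial column is kept as β₀ = `suc (ℓ μ)`, so that only the isolated `f` term is rewritten
  -- by `beyond`.
  Goal : ℕ → Set
  Goal p = cornerSum (binom₂^ k) (suc (ℓ μ)) (outerCorners μ)
           ≡ + binom₂^ k (suc p) ℤ.+ rowSum (Δ (binom₂^ k) ∘ part μ) (ℓ μ)
  eq : Goal (part μ (suc (ℓ μ)))
  eq = trans (cong (λ z → cornerSum (binom₂^ k) z (outerCorners μ))
               (sym (trans (cong (λ z → ℓ μ + suc z) beyond) (+-comm (ℓ μ) 1))))
         (cornerSum-cornersUpToRow (binom₂^ k) μ (ℓ μ) ≤-refl)

-- The effect of adding a box.

-- The enlarged partition is specified only through its boxes, so its parts must be recovered from
-- membership. The last box of a nonempty row determines the part.
part-mono : ∀ μ ν r → (∀ j → (r , j) ∈ᵈ μ → (r , j) ∈ᵈ ν) → part μ r ≤ part ν r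
part-mono μ ν r incl = go (part μ r) refl
  where
  go : ∀ p → part μ r ≡ p → p ≤ part ν r
  go zero    _  = z≤n
  go (suc p) eq = +-cancelˡ-≤ r _ _ (∈ᵈ-≤ ν (incl (r + suc p)
    (∈ᵈ-intro μ (m<m+n r z<s) (≤-reflexive (cong (λ z → r + z) (sym eq))))))

module _ (μ ν : StrictPartition) (b : Box) (b∉μ : b ∉ᵈ μ)
         (spec : ∀ c → c ∈ᵈ ν ⇔ (c ∈ᵈ μ ⊎ c ≡ b)) where

  private
    i = row b
    j = col b

    b∈ν : b ∈ᵈ ν
    b∈ν = from (spec b) (inj₂ refl)

    i<j : i < j
    i<j = ∈ᵈ-< ν b∈ν

  addedRow-bounds : 1 ≤ i × i ≤ ℓ ν
  addedRow-bounds = proj₁ b∈ν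

  part-otherRow : ∀ r → r ≢ i → part ν r ≡ part μ r
  part-otherRow r r≢i = ≤-antisym (part-mono ν μ r fwd) (part-mono μ ν r λ c h → from (spec _) (inj₁ h))
    where
    fwd : ∀ c → (r , c) ∈ᵈ ν → (r , c) ∈ᵈ μ
    fwd c h with to (spec (r , c)) h
    ... | inj₁ h′   = h′
    ... | inj₂ refl = ⊥-elim (r≢i refl)

  private
    -- The box lies just past the end of its row. It cannot lie further left, being outside `μ`. If
    -- it is not the first box of the row, its left neighbour is in `ν` and differs from it, hence
    -- is in `μ`. An empty row `i` of `μ` is covered as well.
    col≡ : j ≡ suc (i + part μ i)
    col≡ = ≤-antisym upper (≰⇒> λ j≤ → b∉μ (∈ᵈ-intro μ i<j j≤))
      where
      1+pred : suc (pred j) ≡ j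
      1+pred = suc-pred j {{>-nonZero (≤-<-trans z≤n i<j)}}
      upper : j ≤ suc (i + part μ i)
      upper with m≤n⇒m<n∨m≡n i<j
      ... | inj₂ e = subst (_≤ suc (i + part μ i)) e (s≤s (m≤m+n i _))
      ... | inj₁ 1+i<j with to (spec (i , pred j))
                             (∈ᵈ-intro ν (s≤s⁻¹ (subst (suc i <_) (sym 1+pred) 1+i<j))
                               (≤-trans (pred[n]≤n {j}) (∈ᵈ-≤ ν b∈ν)))
      ...   | inj₁ h = subst (_≤ suc (i + part μ i)) 1+pred (s≤s (∈ᵈ-≤ μ h))
      ...   | inj₂ e = ⊥-elim (<-irrefl (cong col e) (≤-reflexive 1+pred))

  content-added : content b ≡ suc (part μ i)
  content-added = trans (cong (_∸ i) (trans col≡ (sym (+-suc i (part μ i))))) (m+n∸m≡n i _)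

  part-addedRow : part ν i ≡ suc (part μ i)
  part-addedRow = ≤-antisym upper lower
    where
    lower : suc (part μ i) ≤ part ν i
    lower = +-cancelˡ-≤ i _ _ (subst (_≤ i + part ν i) (trans col≡ (sym (+-suc i _))) (∈ᵈ-≤ ν b∈ν))
    lastBox : (i , i + part ν i) ∈ᵈ ν
    lastBox = ∈ᵈ-intro ν (m<m+n i (≤-trans (s≤s z≤n) lower)) ≤-refl
    upper : part ν i ≤ suc (part μ i)
    upper with to (spec _) lastBox
    ... | inj₁ h = m≤n⇒m≤1+n (+-cancelˡ-≤ i _ _ (∈ᵈ-≤ μ h))
    ... | inj₂ e = ≤-reflexive (+-cancelˡ-≡ i _ _ (trans (cong col e) (trans col≡ (sym (+-suc i _)))))

  q-added : ∀ k → q k ν - q k μ ≡ D k (+ (content b C 2))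
  q-added k = begin
    q k ν - q k μ
      ≡⟨ cong₂ _-_ (q≡rowSum k ν) (q≡rowSum k μ) ⟩
    + binom₂^ k 1 ℤ.+ rowSum (g ν) (ℓ ν) - (+ binom₂^ k 1 ℤ.+ rowSum (g μ) (ℓ μ))
      ≡⟨ eq (+ binom₂^ k 1) (rowSum (g ν) (ℓ ν)) (rowSum (g μ) (ℓ μ)) ⟩
    rowSum (g ν) (ℓ ν) - rowSum (g μ) (ℓ μ)
      -- The new box may start a new row, so both sums are padded with empty rows to the common
      -- length `ℓ μ + ℓ ν`.
      ≡⟨ cong₂ _-_ (sym (rowSum-extend {g ν} (ℓ ν) (vanish ν) (ℓ μ)))
                   (trans (sym (rowSum-extend {g μ} (ℓ μ) (vanish μ) (ℓ ν))) (cong (rowSum (g μ)) (+-comm (ℓ ν) (ℓ μ)))) ⟩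
    rowSum (g ν) (ℓ μ + ℓ ν) - rowSum (g μ) (ℓ μ + ℓ ν)
      ≡⟨ rowSum-update {g μ} {g ν} (ℓ μ + ℓ ν) i (proj₁ addedRow-bounds)
           (≤-trans (proj₂ addedRow-bounds) (m≤n+m (ℓ ν) (ℓ μ)))
           (λ r r≢i → cong (Δ (binom₂^ k)) (part-otherRow r r≢i)) ⟩
    g ν i - g μ i
      ≡⟨ cong (λ z → Δ (binom₂^ k) z - g μ i) part-addedRow ⟩
    Δ (binom₂^ k) (suc (part μ i)) - Δ (binom₂^ k) (part μ i)
      ≡⟨ Δ²-binom₂^ k (part μ i) ⟩
    D k (+ (suc (part μ i) C 2))
      ≡⟨ cong (λ z → D k (+ (z C 2))) (sym content-added) ⟩
    D k (+ (content b C 2)) ∎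
    where
    open ≡-Reasoning
    g : StrictPartition → ℕ → ℤ
    g κ = Δ (binom₂^ k) ∘ part κ
    vanish : ∀ κ r → ℓ κ < r → g κ r ≡ 0ℤ
    -- Both 0 C 2 and 1 C 2 compute to 0, so `Δ (binom₂^ k) 0` is a difference of equal terms, also
    -- for `k = 0`.
    vanish κ r ℓ<r = trans (cong (Δ (binom₂^ k)) (part-beyond-ℓ κ r ℓ<r)) (ℤₚ.+-inverseʳ (+ binom₂^ k 0))
    eq : ∀ a s t → a ℤ.+ s - (a ℤ.+ t) ≡ s - t
    eq = ℤ-Solver.solve-∀

theorem3p5 : ∀ (k : ℕ) → Σ[ ξ ∈ (Fin k → ℚ) ]
    (∀ (μ : StrictPartition) (i : Fin (suc (m μ))) (μⁱ⁺ : StrictPartition) → IsPlus μ i μⁱ⁺ →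
    (q k μⁱ⁺ - q k μ) / 1 ≡ sum +-0-rawMonoid (λ j → ξ j * ((+ ((x μ i C 2) ^ toℕ j)) / 1)))
theorem3p5 k =
  proj₁ coefficients , λ { μ i ν (_ , b , b∉μ , content≡ , spec) → value μ i ν b b∉μ content≡ spec }
  where
  -- Chosen before any partition is given, so the coefficients depend on `k` alone.
  coefficients = polynomialCoefficients (D-polynomial k)
  value : ∀ μ (i : Fin (suc (m μ))) ν b → b ∉ᵈ μ → content b ≡ x μ i →
    (∀ c → c ∈ᵈ ν ⇔ (c ∈ᵈ μ ⊎ c ≡ b)) →
    (q k ν - q k μ) / 1 ≡ sum +-0-rawMonoid (λ j → proj₁ coefficients j * ((+ ((x μ i C 2) ^ toℕ j)) / 1))
  value μ i ν b b∉μ content≡ spec = begin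
    (q k ν - q k μ) / 1             ≡⟨ cong (_/ 1) (q-added μ ν b b∉μ spec k) ⟩
    D k (+ (content b C 2)) / 1     ≡⟨ cong (λ z → D k (+ (z C 2)) / 1) content≡ ⟩
    D k (+ (x μ i C 2)) / 1         ≡⟨ proj₂ coefficients (x μ i C 2) ⟩
    sum +-0-rawMonoid (λ j → proj₁ coefficients j * ((+ ((x μ i C 2) ^ toℕ j)) / 1)) ∎
    where open ≡-Reasoning
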